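{- $\tau(\mathrm{PSG}_4)=10$ and $a(\mathrm{PSG}_4)=4!-\tau(\mathrm{PSG}_4)=14$.
   Context: Two lists $(a_1,\ldots,a_s)$ and $(b_1,\ldots,b_s)$, each with distinct entries, pattern-match if for all $i<j$ we have $a_i<a_j$ if and only if $b_i<b_j$. The pattern-shift graph $\mathrm{PSG}_r$ is the digraph (loops allowed) whose vertices are the permutations of $[r]=\{1,\ldots,r\}$ written as lists, with an edge from $a$ to $b$ (possibly $a=b$) if and only if the list of the last $r-1$ entries of $a$ and the list of the first $r-1$ entries of $b$ pattern-match. For a digraph $G$, $\tau(G)$ is the minimum size of a set of vertices which intersects every directed cycle in $G$, and $a(G)$ is the maximum size of a set of vertices inducing an acyclic subgraph, i.e. one with no directed cycle. Loops count as cycles of length 1, and directed 2-cycles count as cycles. -}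

module Defs where

open import Data.Empty using (⊥)
open import Data.Fin.Base as Fin using (Fin)
open import Data.List.Base using (List; []; _∷_; _∷ʳ_; length; applyUpTo)
open import Data.List.Membership.Propositional using (_∈_)
open import Data.List.Relation.Binary.Permutation.Propositional using (_↭_)
open import Data.List.Relation.Unary.Any using (Any)
open import Data.List.Relation.Unary.Linked using (Linked)
open import Data.List.Relation.Unary.Unique.Propositional using (Unique)
open import Data.Nat.Base using (ℕ; suc; _<_; _≤_; NonZero)
open import Data.Product.Base using (_×_; ∃)
open import Data.Refinement using (Refinement; value)
open import Data.Vec.Base using (Vec; lookup; tail; init; toList)
open import Function.Bundles using (_⇔_)
open import Level using (0ℓ)
open import Relation.Binary.Core using (Rel)
open import Relation.Binary.PropositionalEquality.Core using (_≡_)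
open import Relation.Nullary.Negation.Core using (¬_)
open import Relation.Unary using (Pred)

record Digraph : Set₁ where
  field
    Vertex : Set
    Edge   : Rel Vertex 0ℓ

open Digraph public

-- The list v₀, …, vₖ₋₁ (k ≥ 1) of distinct vertices stands for the directed
-- cycle v₀ → v₁ → ⋯ → vₖ₋₁ → v₀; k = 1 is a loop and k = 2 a directed 2-cycle.
IsCycle : (G : Digraph) → Pred (List (Vertex G)) 0ℓ
IsCycle G []       = ⊥
IsCycle G (v ∷ vs) = Unique (v ∷ vs) × Linked (Edge G) (v ∷ vs ∷ʳ v)

Acyclic : Pred Digraph 0ℓ
Acyclic G = ∀ {c} → ¬ IsCycle G c

-- A set of vertices is given by a list of its elements.  Membership proofs are
-- irrelevant in a refinement type, so each element of S is one vertex.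
induced : (G : Digraph) → List (Vertex G) → Digraph
induced G S = record
  { Vertex = Refinement (Vertex G) (_∈ S)
  ; Edge   = λ u v → Edge G (value u) (value v)
  }

MeetsEveryCycle : (G : Digraph) → Pred (List (Vertex G)) 0ℓ
MeetsEveryCycle G S = ∀ {c} → IsCycle G c → Any (_∈ c) S

InducesAcyclic : (G : Digraph) → Pred (List (Vertex G)) 0ℓ
InducesAcyclic G S = Acyclic (induced G S)

-- Some set of exactly n elements satisfies P: lists without repetition have as
-- many elements as their length.
HasSetOfSize : {A : Set} → Pred (List A) 0ℓ → Pred ℕ 0ℓ
HasSetOfSize P n = ∃ λ S → Unique S × P S × length S ≡ n

IsMinimum IsMaximum : Pred ℕ 0ℓ → Pred ℕ 0ℓ
IsMinimum P n = P n × (∀ {m} → P m → n ≤ m)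
IsMaximum P n = P n × (∀ {m} → P m → m ≤ n)

-- τ(G) = n
τ[_]≡_ : Digraph → ℕ → Set
τ[ G ]≡ n = IsMinimum (HasSetOfSize (MeetsEveryCycle G)) n

-- a(G) = n
a[_]≡_ : Digraph → ℕ → Set
a[ G ]≡ n = IsMaximum (HasSetOfSize (InducesAcyclic G)) n

-- Only meant for vectors with distinct entries.
PatternMatch : ∀ {s} → Rel (Vec ℕ s) 0ℓ
PatternMatch a b = ∀ {i j} → i Fin.< j →
  (lookup a i < lookup a j) ⇔ (lookup b i < lookup b j)

-- Permutations of {1, …, r} in one-line notation.  Two of them are
-- propositionally equal as soon as their entries are.
Permutation : ℕ → Set
Permutation r = Refinement (Vec ℕ r) (λ v → toList v ↭ applyUpTo suc r)

PSG : (r : ℕ) → .{{NonZero r}} → Digraph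
PSG r@(suc _) = record
  { Vertex = Permutation r
  ; Edge   = λ a b → PatternMatch (tail (value a)) (init (value b))
  }

{-# OPTIONS --safe #-}
-- Sending a permutation v to an arrow from the pattern of its first three
-- entries to the pattern of its last three makes PSG 4 the line digraph of a
-- digraph on the six patterns of length 3.  If the patterns are listed in some
-- order, then the arrows that go strictly forward form an acyclic set, and the
-- remaining ones meet every cycle; a suitable order has 14 of the former and 10
-- of the latter.  Both numbers are optimal because the 24 vertices can be
-- partitioned into 10 cycles: a set that meets every cycle has a member in each
-- part, and an acyclic set omits a member of each part.
module Submission where

open import Defs
open import Data.Bool.Base using (Bool; true; false)
open import Data.Fin.Base as Fin using (zero; suc)
import Data.Fin.Properties as Fin
open import Data.Irrelevant using ([_])
open import Data.List.Base using (List; []; _∷_; _∷ʳ_; map; concat; filter; length; applyUpTo; cartesianProductWith)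
open import Data.List.Membership.Propositional using (_∈_; _∉_; find; lose)
open import Data.List.Membership.Propositional.Properties using (∈-filter⁺; ∈-filter⁻; ∈-map⁻; ∈-cartesianProductWith⁺; ∈-++⁺ˡ; ∈-++⁺ʳ)
import Data.List.Membership.DecPropositional as DecMembership
open import Data.List.Properties using (length-++; map-++)
open import Data.List.Relation.Binary.Disjoint.DecPropositional using (disjoint?)
open import Data.List.Relation.Binary.Disjoint.Propositional using (Disjoint)
import Data.List.Relation.Binary.Disjoint.Propositional.Properties as Disjoint
open import Data.List.Relation.Binary.Permutation.Propositional using (_↭_; prep; swap; ↭-refl; ↭-sym; ↭-trans)
open import Data.List.Relation.Binary.Permutation.Propositional.Properties using (All-resp-↭; ∈-resp-↭; ↭-length; drop-∷; ¬x∷xs↭[])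
open import Data.List.Relation.Binary.Subset.Propositional using (_⊆_)
open import Data.List.Relation.Unary.All as All using (All; []; _∷_)
import Data.List.Relation.Unary.All.Properties as All
open import Data.List.Relation.Unary.AllPairs as AllPairs using (AllPairs; []; _∷_; allPairs?)
open import Data.List.Relation.Unary.Any as Any using (Any; here; there; _─_)
open import Data.List.Relation.Unary.Linked as Linked using (Linked; linked?)
import Data.List.Relation.Unary.Linked.Properties as Linked
open import Data.List.Relation.Unary.Unique.DecPropositional using (unique?)
open import Data.List.Relation.Unary.Unique.Propositional using (Unique)
import Data.List.Relation.Unary.Unique.Propositional.Properties as Unique
open import Data.Nat.Base using (ℕ; zero; suc; _+_; _∸_; _!; _<_; _≤_; s≤s; z≤n)
open import Data.Nat.Properties using (_≟_; _<?_; ≤-trans; ≤-reflexive; <-trans; <-irrefl; +-cancelʳ-≤)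
open import Data.Product.Base using (_×_; _,_; ∃; ∃₂; proj₂; uncurry)
import Data.Refinement as Refinement
open Refinement using (value; _,_)
open import Data.Vec.Base as Vec using (Vec; []; _∷_; init; tail; lookup; toList)
import Data.Vec.Properties as Vec
open import Function.Base using (_∘_; _on_)
open import Function.Bundles using (mk⇔; Equivalence)
open import Level using (0ℓ)
open import Relation.Binary.Definitions using (DecidableEquality; Decidable)
open import Relation.Binary.PropositionalEquality.Core using (_≡_; refl; sym; trans; cong; subst)
open import Relation.Nullary.Decidable using (Dec; yes; no; does; True; toWitness; from-yes; map′; recompute; does-⇔; _×-dec_; _→-dec_)
open import Relation.Nullary.Negation.Core using (¬_; contradiction)
open import Relation.Unary using (Pred)
open import Relation.Unary.Properties using (∁?)

private
  variable
    A : Set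
    G : Digraph

-- Counting in lists without repetition, and transversals of disjoint lists.

↭-∷-─ : ∀ {x : A} {xs} (x∈xs : x ∈ xs) → xs ↭ x ∷ (xs ─ x∈xs)
↭-∷-─ (here refl)          = ↭-refl
↭-∷-─ {x = x} (there {y} i) = ↭-trans (prep y (↭-∷-─ i)) (swap y x ↭-refl)

-- Induction on `xs`: one occurrence of the head is deleted from `ys`, and since the head does not
-- recur in the tail, the tail still lies in what is left.
Unique∧⊆⇒length≤ : ∀ {xs ys : List A} → Unique xs → xs ⊆ ys → length xs ≤ length ys
Unique∧⊆⇒length≤ {xs = []} _ _ = z≤n
Unique∧⊆⇒length≤ {xs = x ∷ xs} {ys} (x∉xs ∷ xs!) xs⊆ys =
  ≤-trans (s≤s (Unique∧⊆⇒length≤ xs! xs⊆)) (≤-reflexive (sym (↭-length ys↭)))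
  where
  ys↭ : ys ↭ x ∷ (ys ─ xs⊆ys (here refl))
  ys↭ = ↭-∷-─ (xs⊆ys (here refl))

  xs⊆ : xs ⊆ (ys ─ xs⊆ys (here refl))
  xs⊆ z∈xs with ∈-resp-↭ ys↭ (xs⊆ys (there z∈xs))
  ... | here refl = contradiction refl (All.lookup x∉xs z∈xs)
  ... | there z∈  = z∈

module _ (_≟ᴬ_ : DecidableEquality A) where

  open DecMembership _≟ᴬ_ using (_∈?_)

  ↭-dec : Decidable (_↭_ {A = A})
  ↭-dec []       []       = yes ↭-refl
  ↭-dec []       (_ ∷ _)  = no (¬x∷xs↭[] ∘ ↭-sym)
  ↭-dec (x ∷ xs) ys with x ∈? ys
  ... | no x∉ys  = no λ p → x∉ys (∈-resp-↭ p (here refl))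
  ... | yes x∈ys = map′
    (λ p → ↭-trans (prep x p) (↭-sym (↭-∷-─ x∈ys)))
    (λ p → drop-∷ (↭-trans p (↭-∷-─ x∈ys)))
    (↭-dec xs (ys ─ x∈ys))

-- One element with `P` is chosen from each list, and disjointness keeps the choices distinct. The
-- inclusion in `concat xss` is carried along for the induction: it separates a new choice from the
-- earlier ones.
transversal : ∀ {P : Pred A 0ℓ} {xss} → AllPairs Disjoint xss → All (Any P) xss →
  ∃ λ ts → Unique ts × All P ts × ts ⊆ concat xss × length ts ≡ length xss
transversal [] [] = [] , [] , [] , (λ ()) , refl
transversal {P = P} {xs ∷ xss} (xs# ∷ xss#) (px ∷ pxs)
  with x , x∈xs , p ← find px
     | ts , ts! , ps , ts⊆ , eq ← transversal {P = P} xss# pxs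
  = x ∷ ts , All.tabulate x≢ ∷ ts! , p ∷ ps , ⊆concat , cong suc eq
  where
  x≢ : ∀ {y} → y ∈ ts → ¬ x ≡ y
  x≢ y∈ts refl = Disjoint.concat⁺ʳ xs# (x∈xs , ts⊆ y∈ts)

  ⊆concat : x ∷ ts ⊆ concat (xs ∷ xss)
  ⊆concat (here refl) = ∈-++⁺ˡ x∈xs
  ⊆concat (there i)   = ∈-++⁺ʳ xs (ts⊆ i)

-- Cycles and acyclic sets in an arbitrary digraph.

-- Along a cycle written with its first vertex repeated at the end, transitivity would give
-- `f v < f v`.
rising⇒acyclic : (f : Vertex G → ℕ) → (∀ {u v} → Edge G u v → f u < f v) → Acyclic G
rising⇒acyclic {G} f rises {v ∷ vs} (_ , linked) =
  <-irrefl refl (proj₂ (All.∷ʳ⁻ (AllPairs.head rising)))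
  where
  rising : AllPairs (_<_ on f) (v ∷ vs ∷ʳ v)
  rising = Linked.Linked⇒AllPairs (λ {i} {j} {k} → <-trans {f i} {f j} {f k})
             (Linked.map rises linked)

module _ {S : List (Vertex G)} where

  isCycle-induced⁺ : ∀ c → IsCycle G (map value c) → IsCycle (induced G S) c
  isCycle-induced⁺ (v ∷ vs) (unique , linked) =
    Unique.map⁻ unique ,
    Linked.map⁻ (subst (Linked (Edge G)) (sym (map-++ value (v ∷ vs) (v ∷ []))) linked)

  attach : ∀ {c} → All (_∈ S) c → List (Vertex (induced G S))
  attach = All.reduce (λ {v} v∈S → v , [ v∈S ])

  map-value-attach : ∀ {c} (c⊆S : All (_∈ S) c) → map value (attach c⊆S) ≡ c
  map-value-attach []          = refl
  map-value-attach (_ ∷ c⊆S) = cong (_ ∷_) (map-value-attach c⊆S)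

module _ (_≟ⱽ_ : DecidableEquality (Vertex G)) where

  open DecMembership _≟ⱽ_ using (_∈?_)

  -- A cycle lying wholly in `S` would lift to a cycle of the induced digraph; decidable membership
  -- then yields an actual vertex outside `S`.
  acyclic⇒cycle-leaves : ∀ {S c} → InducesAcyclic G S → IsCycle G c → Any (_∉ S) c
  acyclic⇒cycle-leaves {S} {c} acyclic cycle =
    All.¬All⇒Any¬ (_∈? S) c λ c⊆S → acyclic
      (isCycle-induced⁺ (attach {G} c⊆S)
        (subst (IsCycle G) (sym (map-value-attach {G} c⊆S)) cycle))

  complement-acyclic⇒meets : ∀ {S T} → (∀ v → v ∉ T → v ∈ S) →
    InducesAcyclic G T → MeetsEveryCycle G S
  complement-acyclic⇒meets cover acyclic cycle
    with v , v∈c , v∉T ← find (acyclic⇒cycle-leaves acyclic cycle)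
    = lose (cover v v∉T) v∈c

  module _ (edge? : Decidable (Edge G)) where

    isCycle? : ∀ c → Dec (IsCycle G c)
    isCycle? []       = no λ ()
    isCycle? (v ∷ vs) = unique? _≟ⱽ_ (v ∷ vs) ×-dec linked? edge? (v ∷ vs ∷ʳ v)

-- Bounds from a packing of disjoint cycles.

module _ {cs : List (List (Vertex G))}
         (cycles : All (IsCycle G) cs) (disjoint : AllPairs Disjoint cs) where

  packing⇒meets-≥ : ∀ {S} → MeetsEveryCycle G S → length cs ≤ length S
  packing⇒meets-≥ {S} meets
    with ts , ts! , ts⊆S , _ , eq ← transversal {P = _∈ S} disjoint
           (All.map (λ cycle → let _ , v∈S , v∈c = find (meets cycle) in lose v∈c v∈S) cycles)
    = subst (_≤ length S) eq (Unique∧⊆⇒length≤ ts! (All.lookup ts⊆S))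

  -- Choosing from each cycle a vertex outside `S` gives `length cs` distinct vertices; appended to
  -- `S` they still form a list without repetition, so it is no longer than the list of all
  -- vertices.
  packing⇒acyclic-≤ : DecidableEquality (Vertex G) → (∀ v → v ∈ concat cs) →
    ∀ {S} → Unique S → InducesAcyclic G S → length S + length cs ≤ length (concat cs)
  packing⇒acyclic-≤ _≟ⱽ_ complete {S} S! acyclic
    with ts , ts! , ts∉S , _ , eq ← transversal {P = _∉ S} disjoint
           (All.map (acyclic⇒cycle-leaves _≟ⱽ_ acyclic) cycles)
    = subst (_≤ length (concat cs)) (trans (length-++ S) (cong (length S +_) eq))
        (Unique∧⊆⇒length≤
          (Unique.++⁺ S! ts! λ (v∈S , v∈ts) → All.lookup ts∉S v∈ts v∈S)
          (λ {v} _ → complete v))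

-- Partition of the vertices of `PSG 4` into ten cycles.

patternMatch? : ∀ {s} → Decidable (PatternMatch {s})
patternMatch? a b = map′ (λ f {i} {j} → f i j) (λ f i j → f {i} {j})
  (Fin.all? λ i → Fin.all? λ j → i Fin.<? j →-dec
    map′ (uncurry mk⇔) (λ e → Equivalence.to e , Equivalence.from e)
      ((a< i j →-dec b< i j) ×-dec (b< i j →-dec a< i j)))
  where
  a< = λ i j → lookup a i <? lookup a j
  b< = λ i j → lookup b i <? lookup b j

_≟ᵖ_ : ∀ {r} → DecidableEquality (Permutation r)
_≟ᵖ_ = Refinement._≟_ (Vec.≡-dec _≟_)

edge? : Decidable (Edge (PSG 4))
edge? a b = patternMatch? (tail (value a)) (init (value b))

-- The hidden argument is solved by running `↭-dec`, so only genuine permutations of 1, 2, 3, 4 can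
-- be written this way.
⟨_,_,_,_⟩ : (w x y z : ℕ) →
  {_ : True (↭-dec _≟_ (w ∷ x ∷ y ∷ z ∷ []) (applyUpTo suc 4))} → Permutation 4
⟨ w , x , y , z ⟩ {p} = (w ∷ x ∷ y ∷ z ∷ []) , [ toWitness p ]

-- Two loops at the monotone permutations, two 2-cycles of alternating permutations and six
-- 3-cycles: 2 + 4 + 18 = 24 vertices.
cycles : List (List (Permutation 4))
cycles =
  (⟨ 1 , 2 , 3 , 4 ⟩ ∷ []) ∷
  (⟨ 4 , 3 , 2 , 1 ⟩ ∷ []) ∷
  (⟨ 1 , 3 , 2 , 4 ⟩ ∷ ⟨ 3 , 1 , 4 , 2 ⟩ ∷ []) ∷
  (⟨ 2 , 4 , 1 , 3 ⟩ ∷ ⟨ 4 , 2 , 3 , 1 ⟩ ∷ []) ∷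
  (⟨ 1 , 2 , 4 , 3 ⟩ ∷ ⟨ 1 , 4 , 2 , 3 ⟩ ∷ ⟨ 3 , 1 , 2 , 4 ⟩ ∷ []) ∷
  (⟨ 1 , 3 , 4 , 2 ⟩ ∷ ⟨ 3 , 4 , 1 , 2 ⟩ ∷ ⟨ 4 , 1 , 2 , 3 ⟩ ∷ []) ∷
  (⟨ 1 , 4 , 3 , 2 ⟩ ∷ ⟨ 4 , 2 , 1 , 3 ⟩ ∷ ⟨ 2 , 1 , 4 , 3 ⟩ ∷ []) ∷
  (⟨ 2 , 1 , 3 , 4 ⟩ ∷ ⟨ 2 , 3 , 4 , 1 ⟩ ∷ ⟨ 2 , 3 , 1 , 4 ⟩ ∷ []) ∷
  (⟨ 2 , 4 , 3 , 1 ⟩ ∷ ⟨ 4 , 3 , 1 , 2 ⟩ ∷ ⟨ 4 , 1 , 3 , 2 ⟩ ∷ []) ∷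
  (⟨ 3 , 2 , 1 , 4 ⟩ ∷ ⟨ 3 , 2 , 4 , 1 ⟩ ∷ ⟨ 3 , 4 , 2 , 1 ⟩ ∷ []) ∷
  []

vertices : List (Permutation 4)
vertices = concat cycles

cycles-areCycles : All (IsCycle (PSG 4)) cycles
cycles-areCycles = from-yes (All.all? (isCycle? _≟ᵖ_ edge?) cycles)

cycles-disjoint : AllPairs Disjoint cycles
cycles-disjoint = from-yes (allPairs? (disjoint? _≟ᵖ_) cycles)

vertices-unique : Unique vertices
vertices-unique = from-yes (unique? _≟ᵖ_ vertices)

words : List A → (n : ℕ) → List (Vec A n)
words xs zero    = [] ∷ []
words xs (suc n) = cartesianProductWith _∷_ xs (words xs n)

∈-words : ∀ {xs : List A} {n} (v : Vec A n) → All (_∈ xs) (toList v) → v ∈ words xs n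
∈-words []      []         = here refl
∈-words (x ∷ v) (x∈ ∷ v∈) = ∈-cartesianProductWith⁺ _∷_ x∈ (∈-words v v∈)

_∈ᵛ?_ : ∀ {n} → Decidable (_∈_ {A = Vec ℕ n})
_∈ᵛ?_ = DecMembership._∈?_ (Vec.≡-dec _≟_)

-- A permutation of 1, 2, 3, 4 is one of the 256 words of length 4 over these letters, and all of
-- them are checked by evaluation.
values-complete : ∀ v → toList v ↭ applyUpTo suc 4 → v ∈ map value vertices
values-complete v v-perm =
  All.lookup words-complete (∈-words v (All-resp-↭ (↭-sym v-perm) (All.tabulate λ x∈ → x∈))) v-perm
  where
  words-complete : All (λ w → toList w ↭ applyUpTo suc 4 → w ∈ map value vertices)
                       (words (applyUpTo suc 4) 4)
  words-complete = from-yes (All.all?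
    (λ w → ↭-dec _≟_ (toList w) (applyUpTo suc 4) →-dec w ∈ᵛ? map value vertices)
    (words (applyUpTo suc 4) 4))

vertices-complete : ∀ v → v ∈ vertices
vertices-complete (v , [ v-perm ])
  -- The proof `v-perm` is irrelevant, so membership of the bare vector is recomputed by decision;
  -- equal vectors then give equal vertices.
  with _ , u∈ , refl ← ∈-map⁻ value (recompute (v ∈ᵛ? map value vertices) (values-complete v v-perm))
  = u∈

-- The position of the pattern of (x , y , z) in the order
-- 123, 132, 231, 321, 213, 312, from the truth values of x < y, x < z and y < z.
-- The combinations true, false, true and false, true, false do not occur.
rank : Bool → Bool → Bool → ℕ
rank true  true  true  = 0
rank true  true  false = 1
rank true  false _     = 2
rank false false false = 3
rank false true  _     = 4
rank false false true  = 5

position : Vec ℕ 3 → ℕ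
position (x ∷ y ∷ z ∷ []) = rank (does (x <? y)) (does (x <? z)) (does (y <? z))

-- The three comparisons that determine `rank` are exactly those that pattern-matching preserves.
-- Hence, along an edge, the target of one arrow has the position of the source of the next.
position-cong : ∀ a b → PatternMatch a b → position a ≡ position b
position-cong (x ∷ y ∷ z ∷ []) (x′ ∷ y′ ∷ z′ ∷ []) match
  rewrite does-⇔ (match {zero} {suc zero} (s≤s z≤n)) (x <? y) (x′ <? y′)
        | does-⇔ (match {zero} {suc (suc zero)} (s≤s z≤n)) (x <? z) (x′ <? z′)
        | does-⇔ (match {suc zero} {suc (suc zero)} (s≤s (s≤s z≤n))) (y <? z) (y′ <? z′)
  = refl

source target : Permutation 4 → ℕ
source v = position (init (value v))
target v = position (tail (value v))

Forward : Pred (Permutation 4) 0ℓ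
Forward v = source v < target v

forward? : ∀ v → Dec (Forward v)
forward? v = source v <? target v

forward nonforward : List (Permutation 4)
forward    = filter forward? vertices
nonforward = filter (∁? forward?) vertices

-- `source` rises along each edge from `u` to `v`: `source u < target u` because `u` is forward, and
-- `target u` equals `source v`.
forward-acyclic : InducesAcyclic (PSG 4) forward
forward-acyclic = rising⇒acyclic (source ∘ value) λ {u} {v} → rises {u} {v}
  where
  rises : ∀ {u v} → Edge (induced (PSG 4) forward) u v → source (value u) < source (value v)
  rises {u , [ u∈ ]} {v , _} u→v = subst (source u <_)
    (position-cong (tail (value u)) (init (value v)) u→v)
    -- Membership in `forward` is irrelevant inside the induced digraph, so the inequality is
    -- recovered by deciding it.
    (recompute (forward? u) (proj₂ (∈-filter⁻ forward? {xs = vertices} u∈)))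

∉forward⇒∈nonforward : ∀ v → v ∉ forward → v ∈ nonforward
∉forward⇒∈nonforward v v∉ =
  ∈-filter⁺ (∁? forward?) (vertices-complete v) (v∉ ∘ ∈-filter⁺ forward? (vertices-complete v))

-- The two optimal values.

τ-PSG₄ : τ[ PSG 4 ]≡ 10
τ-PSG₄ =
  ( nonforward
  , Unique.filter⁺ (∁? forward?) vertices-unique
  , complement-acyclic⇒meets _≟ᵖ_ ∉forward⇒∈nonforward forward-acyclic
  -- Evaluating the filter shows that ten of the 24 vertices are not forward.
  , refl ) ,
  λ { (_ , _ , meets , refl) → packing⇒meets-≥ cycles-areCycles cycles-disjoint meets }

a-PSG₄ : a[ PSG 4 ]≡ 14
a-PSG₄ =
  (forward , Unique.filter⁺ forward? vertices-unique , forward-acyclic , refl) ,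
  -- The packing bound reads `length S + 10 ≤ 24`, and 24 is 14 + 10.
  λ { (S , S! , acyclic , refl) → +-cancelʳ-≤ 10 (length S) 14
        (packing⇒acyclic-≤ cycles-areCycles cycles-disjoint _≟ᵖ_ vertices-complete S! acyclic) }

proposition29 : ∃₂ λ (t α : ℕ) →
    (τ[ PSG 4 ]≡ t) × (a[ PSG 4 ]≡ α) × (t ≡ 10) × (α ≡ 4 ! ∸ t) × (4 ! ∸ t ≡ 14)
proposition29 = 10 , 14 , τ-PSG₄ , a-PSG₄ , refl , refl , refl
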